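{- Let $T$ be a tree set of characteristic $1$ on the alphabet $\Sigma$, closed under reversal (i.e. $a_1a_2\cdots a_n\in T$ implies $a_n\cdots a_2a_1\in T$). Let $\mathcal{A}$ be a doubling transducer with input alphabet $\Sigma$ and output alphabet $A$, and let $\delta_{\mathcal{A}}=(\delta_0,\delta_1)$ be the corresponding doubling map. Then the image $S=\delta_0(T)\cup\delta_1(T)$ of $T$ by $\delta_{\mathcal{A}}$ is a specular set on $A$ relative to the involution $\theta_{\mathcal{A}}$.
   Context: Words are over finite alphabets; $\varepsilon$ is the empty word. A set $S$ of words on an alphabet $A$ is factorial if it contains $A$ and all the factors of its elements. For $w\in S$ let $L(w)=\{a\in A\mid aw\in S\}$, $R(w)=\{a\in A\mid wa\in S\}$, $B(w)=\{(a,b)\in A\times A\mid awb\in S\}$. A factorial set $S$ is biextendable if $B(w)\neq\emptyset$ for all $w\in S$. The extension graph $\mathcal{E}(w)$ is the undirected graph whose vertex set is the disjoint union of $L(w)$ and $R(w)$ and whose edges are the pairs in $B(w)$. A biextendable set $S$ is a tree set of characteristic $c$ if $\mathcal{E}(w)$ is a tree for every nonempty $w\in S$ and $\mathcal{E}(\varepsilon)$ is a disjoint union of $c$ trees. Let $\theta$ be an involution on $A$ (possibly with fixed points) and let $G_\theta$ be the group generated by $A$ with relations $a\theta(a)=1$, $a\in A$ (so $a^{ -1}=\theta(a)$). A word is reduced if it has no factor $a\theta(a)$ with $a\in A$; every element of $G_\theta$ is represented by a unique reduced word, so the inverse of a reduced word $a_1\cdots a_n$ is the reduced word $\theta(a_n)\cdots\theta(a_1)$.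 A laminary set on $A$ relative to $\theta$ is a biextendable set of reduced words closed under taking inverses. A specular set relative to $\theta$ is a laminary set which is a tree set of characteristic $2$. A doubling transducer $\mathcal{A}$ is a directed labeled graph with set of states $\{0,1\}$, each edge being of the form $(i,\alpha,a,j)$ (from state $i$ to state $j$, with input letter $\alpha\in\Sigma$ and output letter $a\in A$), such that: (1) every letter of $\Sigma$ acts on $\{0,1\}$ as a permutation (for each state $i$ and each $\alpha\in\Sigma$ there is exactly one edge leaving $i$ with input $\alpha$, and the map sending $i$ to the end of this edge is a permutation of $\{0,1\}$); (2) the output labels of the edges are all distinct. The alphabet $A$ is the set of output labels of the edges. For $i\in\{0,1\}$, the map $\delta_i:\Sigma^*\to A^*$ sends $u$ to the output label of the path starting at state $i$ with input label $u$. The involution $\theta_{\mathcal{A}}$ on $A$ is defined as follows: for $a\in A$, let $(i,\alpha,a,j)$ be the edge with output $a$; then $\theta_{\mathcal{A}}(a)$ is the output label of the edge starting at $1-j$ with input label $\alpha$. -}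

module Defs where

open import Algebra.Definitions using (Involutive)
open import Data.Empty using (⊥)
open import Data.Fin using (Fin; opposite)
open import Data.Fin.Patterns using (0F; 1F)
open import Data.List using (List; []; _∷_; [_]; _++_; _∷ʳ_; length; map; reverse)
open import Data.List.Properties using (++-identityʳ)
open import Data.List.Relation.Unary.Linked using (Linked)
open import Data.List.Relation.Unary.Unique.Propositional using (Unique)
open import Data.Nat using (ℕ; _≤_)
open import Data.Product using (∃; _×_; _,_; proj₁; uncurry)
open import Data.Sum using (_⊎_; inj₁; inj₂)
open import Function.Definitions using (Injective; Bijective; StrictlySurjective)
open import Level using (0ℓ)
open import Relation.Binary.Construct.Closure.ReflexiveTransitive using (Star)
open import Relation.Binary.Core using (Rel)
open import Relation.Binary.Definitions using (Symmetric)
open import Relation.Binary.PropositionalEquality using (_≡_; _≢_; subst; sym)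
open import Relation.Nullary using (¬_)
open import Relation.Unary using (Pred; _∈_; _∪_)

-- Simple undirected graphs whose vertex set is a subset of the type V.
record Graph (V : Set) : Set₁ where
  field
    Vertex     : Pred V 0ℓ
    Adj        : Rel V 0ℓ
    adj-sym    : Symmetric Adj
    adj-irrefl : ∀ {v} → ¬ Adj v v
    adj-vertex : ∀ {u v} → Adj u v → Vertex u

module _ {V : Set} where

  induced : Graph V → Pred V 0ℓ → Graph V
  induced G P = record
    { Vertex     = λ v → Vertex v × P v
    ; Adj        = λ u v → Adj u v × P u × P v
    ; adj-sym    = λ (e , pu , pv) → adj-sym e , pv , pu
    ; adj-irrefl = λ (e , _) → adj-irrefl e
    ; adj-vertex = λ (e , pu , _) → adj-vertex e , pu
    }
    where open Graph G

  Connected : Graph V → Set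
  Connected G = ∀ {u v} → Vertex u → Vertex v → Star Adj u v
    where open Graph G

  -- A cycle v, v₁, …, vₖ, v has k ≥ 2 and v, v₁, …, vₖ pairwise distinct.
  Acyclic : Graph V → Set
  Acyclic G = ∀ v vs → 2 ≤ length vs → Unique (v ∷ vs) → ¬ Linked Adj (v ∷ vs ∷ʳ v)
    where open Graph G

  record IsTree (G : Graph V) : Set where
    field
      nonempty  : ∃ (Graph.Vertex G)
      connected : Connected G
      acyclic   : Acyclic G

  record IsDisjointUnionOfTrees (c : ℕ) (G : Graph V) : Set₁ where
    open Graph G
    field
      Part     : Fin c → Pred V 0ℓ
      covers   : ∀ {v} → Vertex v → ∃ λ i → v ∈ Part i
      disjoint : ∀ {i j v} → v ∈ Part i → v ∈ Part j → i ≡ j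
      closed   : ∀ {i u v} → Adj u v → u ∈ Part i → v ∈ Part i
      trees    : ∀ i → IsTree (induced G (Part i))

module _ {A : Set} (S : Pred (List A) 0ℓ) where

  L : List A → Pred A 0ℓ
  L w a = (a ∷ w) ∈ S

  R : List A → Pred A 0ℓ
  R w a = (w ∷ʳ a) ∈ S

  B : List A → Pred (A × A) 0ℓ
  B w (a , b) = (a ∷ w ∷ʳ b) ∈ S

  record IsFactorial : Set where
    field
      letters : ∀ a → [ a ] ∈ S
      factors : ∀ x u y → (x ++ u ++ y) ∈ S → u ∈ S

  record IsBiextendable : Set where
    field
      isFactorial : IsFactorial
      extendable  : ∀ {w} → w ∈ S → ∃ λ ab → ab ∈ B w
    open IsFactorial isFactorial public

  -- inj₁ and inj₂ tag the elements of L(w) and of R(w) respectively.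
  extensionGraph : IsFactorial → List A → Graph (A ⊎ A)
  extensionGraph factorial w = record
    { Vertex     = Vertex
    ; Adj        = Adj
    ; adj-sym    = λ {u} {v} → adj-sym u v
    ; adj-irrefl = λ {v} → adj-irrefl v
    ; adj-vertex = λ {u} {v} → adj-vertex u v
    }
    where
    open IsFactorial factorial

    Vertex : Pred (A ⊎ A) 0ℓ
    Vertex (inj₁ a) = a ∈ L w
    Vertex (inj₂ b) = b ∈ R w

    Adj : Rel (A ⊎ A) 0ℓ
    Adj (inj₁ a) (inj₂ b) = (a , b) ∈ B w
    Adj (inj₂ b) (inj₁ a) = (a , b) ∈ B w
    Adj (inj₁ _) (inj₁ _) = ⊥
    Adj (inj₂ _) (inj₂ _) = ⊥

    adj-sym : ∀ u v → Adj u v → Adj v u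
    adj-sym (inj₁ _) (inj₂ _) e = e
    adj-sym (inj₂ _) (inj₁ _) e = e

    adj-irrefl : ∀ v → ¬ Adj v v
    adj-irrefl (inj₁ _) ()
    adj-irrefl (inj₂ _) ()

    adj-vertex : ∀ u v → Adj u v → Vertex u
    adj-vertex (inj₁ a) (inj₂ b) e = factors [] (a ∷ w) [ b ] e
    adj-vertex (inj₂ b) (inj₁ a) e =
      factors [ a ] (w ∷ʳ b) [] (subst (λ z → (a ∷ z) ∈ S) (sym (++-identityʳ (w ∷ʳ b))) e)

  record IsTreeSet (c : ℕ) : Set₁ where
    field
      isBiextendable : IsBiextendable
    open IsBiextendable isBiextendable public
    field
      nonempty-words : ∀ {w} → w ∈ S → w ≢ [] → IsTree (extensionGraph isFactorial w)
      empty-word     : IsDisjointUnionOfTrees c (extensionGraph isFactorial [])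

  ClosedUnderReversal : Set
  ClosedUnderReversal = ∀ {w} → w ∈ S → reverse w ∈ S

module _ {A : Set} (θ : A → A) where

  Reduced : Pred (List A) 0ℓ
  Reduced w = ∀ x a y → w ≢ x ++ a ∷ θ a ∷ y

  -- The reduced word representing the inverse in G_θ of a reduced word.
  inverse : List A → List A
  inverse w = reverse (map θ w)

  record IsLaminary (S : Pred (List A) 0ℓ) : Set where
    field
      involutive     : Involutive _≡_ θ
      isBiextendable : IsBiextendable S
      reduced        : ∀ {w} → w ∈ S → Reduced w
      inverse-closed : ∀ {w} → w ∈ S → inverse w ∈ S

  record IsSpecular (S : Pred (List A) 0ℓ) : Set₁ where
    field
      isLaminary : IsLaminary S
      isTreeSet  : IsTreeSet S 2

State : Set
State = Fin 2

-- The edges are the quadruples (i , α , output i α , next i α).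
record DoublingTransducer (Γ A : Set) : Set where
  field
    next               : State → Γ → State
    output             : State → Γ → A
    next-permutation   : ∀ α → Bijective _≡_ _≡_ (λ i → next i α)
    outputs-distinct   : Injective _≡_ _≡_ (uncurry output)
    -- A is the set of output labels.
    outputs-exhaustive : StrictlySurjective _≡_ (uncurry output)

  δ : State → List Γ → List A
  δ i []      = []
  δ i (α ∷ u) = output i α ∷ δ (next i α) u

  -- opposite j is 1 - j.
  θ : A → A
  θ a = let (i , α) = proj₁ (outputs-exhaustive a)
        in output (opposite (next i α)) α

  doublingImage : Pred (List Γ) 0ℓ → Pred (List A) 0ℓ
  doublingImage T = image (δ 0F) ∪ image (δ 1F)
    where
    image : (List Γ → List A) → Pred (List A) 0ℓ
    image f w = ∃ λ u → u ∈ T × f u ≡ w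

{-# OPTIONS --safe #-}
module Submission where

-- Write a letter of A as an edge of the transducer with a start, an end and an input.
-- A word of A is in S iff it labels a path and its word of inputs is in T. A nonempty
-- word determines the end states of its path, so its extension graph in S is isomorphic,
-- by taking inputs, to the extension graph in T of its input word. The empty path can be
-- placed at either state, so the extension graph of ε in S is two copies of the one in T.
-- Finally θ turns the edge i → j into the edge 1-j → 1-i with the same input.

open import Defs
open import Data.Empty using (⊥-elim)
open import Data.Fin using (Fin; opposite)
open import Data.Fin.Patterns using (0F; 1F)
open import Data.Fin.Properties using (opposite-involutive)
open import Data.List using (List; []; _∷_; [_]; _++_; _∷ʳ_; map; reverse)
open import Data.List.Properties using (map-++; map-cong; map-id-local; map-∘; reverse-map; unfold-reverse)
open import Data.List.Relation.Unary.All as All using (All; []; _∷_)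
open import Data.List.Relation.Unary.All.Properties using (++⁻ˡ)
open import Data.List.Relation.Unary.AllPairs as AllPairs using ()
import Data.List.Relation.Unary.AllPairs.Properties as AllPairs
open import Data.List.Relation.Unary.Linked as Linked using (Linked; []; [-]; _∷_)
import Data.List.Relation.Unary.Linked.Properties as Linked
open import Data.List.Relation.Unary.Unique.Propositional using (Unique)
open import Data.Nat using (ℕ; z≤n; s≤s)
open import Data.Product using (∃; ∃₂; _×_; _,_; proj₁; proj₂)
open import Data.Sum as Sum using (_⊎_; inj₁; inj₂)
open import Function using (_∘_)
open import Level using (0ℓ)
open import Relation.Binary.Construct.Closure.ReflexiveTransitive as Star using (Star)
open import Relation.Binary.PropositionalEquality using (_≡_; _≢_; refl; sym; trans; cong; cong₂; subst; subst₂; module ≡-Reasoning)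
open import Relation.Unary using (Pred; _∈_; _⊆_)

-- Trees, induced subgraphs and transfer between graphs.

module _ {V : Set} (G : Graph V) where
  open Graph G

  linked⇒vertices : ∀ {u v vs} → Linked Adj (u ∷ v ∷ vs) → All Vertex (u ∷ v ∷ vs)
  linked⇒vertices (e ∷ [-])    = adj-vertex e ∷ adj-vertex (adj-sym e) ∷ []
  linked⇒vertices (e ∷ e′ ∷ l) = adj-vertex e ∷ linked⇒vertices (e′ ∷ l)

  -- Lets `tree-transfer` apply `f (g w) ≡ w`, which is given on vertices only, to all entries of a
  -- cycle.
  closedWalk⇒vertices : ∀ v vs → Linked Adj (v ∷ vs ∷ʳ v) → All Vertex (v ∷ vs)
  closedWalk⇒vertices v []       l = All.head (linked⇒vertices l) ∷ []
  closedWalk⇒vertices v (u ∷ vs) l = ++⁻ˡ (v ∷ u ∷ vs) (linked⇒vertices l)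

  tree-of-full-induced : {P : Pred V 0ℓ} → Vertex ⊆ P → IsTree (induced G P) → IsTree G
  tree-of-full-induced full t = record
    { nonempty  = proj₁ nonempty , proj₁ (proj₂ nonempty)
    ; connected = λ u v → Star.map proj₁ (connected (u , full u) (v , full v))
    ; acyclic   = λ v vs 2≤ uniq l → acyclic v vs 2≤ uniq
        (Linked.map (λ e → e , full (adj-vertex e) , full (adj-vertex (adj-sym e))) l)
    }
    where open IsTree t

  tree-of-one : IsDisjointUnionOfTrees 1 G → IsTree G
  tree-of-one d = tree-of-full-induced inPart (trees 0F)
    where
    open IsDisjointUnionOfTrees d
    inPart : Vertex ⊆ Part 0F
    inPart v with covers v
    ... | 0F , p = p

-- Walks from `g u` to `g v` are pushed forward along `f`. Cycles are pulled back along `g`, which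
-- is injective on the vertices of `H` because `f` undoes it there.
tree-transfer : {V W : Set} (G : Graph V) (H : Graph W) (f : V → W) (g : W → V) →
  let module G = Graph G; module H = Graph H in
  (∀ {v} → G.Vertex v → H.Vertex (f v)) →
  (∀ {w} → H.Vertex w → G.Vertex (g w)) →
  (∀ {u v} → G.Adj u v → H.Adj (f u) (f v)) →
  (∀ {u v} → H.Adj u v → G.Adj (g u) (g v)) →
  (∀ {w} → H.Vertex w → f (g w) ≡ w) →
  IsTree G → IsTree H
tree-transfer G H f g f-vertex g-vertex f-adj g-adj fg t = record
  { nonempty  = f (proj₁ nonempty) , f-vertex (proj₂ nonempty)
  ; connected = λ u v → subst₂ (Star H.Adj) (fg u) (fg v)
      (Star.gmap f f-adj (connected (g-vertex u) (g-vertex v)))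
  ; acyclic   = acyc
  }
  where
  module G = Graph G
  module H = Graph H
  open IsTree t

  unique-map : ∀ {ws} → All H.Vertex ws → Unique ws → Unique (map g ws)
  unique-map {ws} vertices uniq = AllPairs.map (_∘ cong f) (AllPairs.map⁻
    (subst Unique (sym (trans (sym (map-∘ ws)) (map-id-local (All.map fg vertices)))) uniq))

  acyc : Acyclic H
  -- Exposing two entries makes the length bound for the mapped list evident.
  acyc v (a ∷ b ∷ vs) 2≤ uniq l = acyclic (g v) (map g (a ∷ b ∷ vs)) (s≤s (s≤s z≤n))
    (unique-map (closedWalk⇒vertices H v _ l) uniq)
    (subst (λ x → Linked G.Adj (g v ∷ x)) (map-++ g (a ∷ b ∷ vs) [ v ]) (Linked.map⁺ (Linked.map g-adj l)))
  acyc v (_ ∷ []) (s≤s ())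

opposite-≢ : ∀ (i : State) → i ≢ opposite i
opposite-≢ 0F ()
opposite-≢ 1F ()

≡⊎≡opposite : ∀ (i j : State) → j ≡ i ⊎ j ≡ opposite i
≡⊎≡opposite 0F 0F = inj₁ refl
≡⊎≡opposite 0F 1F = inj₂ refl
≡⊎≡opposite 1F 0F = inj₂ refl
≡⊎≡opposite 1F 1F = inj₁ refl

-- Letters as edges, and the involution.

module Transducer {Γ A : Set} (𝒜 : DoublingTransducer Γ A) where
  open DoublingTransducer 𝒜

  start : A → State
  start a = proj₁ (proj₁ (outputs-exhaustive a))

  input : A → Γ
  input a = proj₂ (proj₁ (outputs-exhaustive a))

  end : A → State
  end a = next (start a) (input a)

  output-start-input : ∀ a → output (start a) (input a) ≡ a
  output-start-input a = proj₂ (outputs-exhaustive a)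

  start-output : ∀ i α → start (output i α) ≡ i
  start-output i α = cong proj₁ (outputs-distinct (output-start-input (output i α)))

  input-output : ∀ i α → input (output i α) ≡ α
  input-output i α = cong proj₂ (outputs-distinct (output-start-input (output i α)))

  end-output : ∀ i α → end (output i α) ≡ next i α
  end-output i α = cong₂ next (start-output i α) (input-output i α)

  next-injective : ∀ {i j} α → next i α ≡ next j α → i ≡ j
  next-injective α = proj₁ (next-permutation α)

  prev : State → Γ → State
  prev i α = proj₁ (proj₂ (next-permutation α) i)

  next-prev : ∀ i α → next (prev i α) α ≡ i
  next-prev i α = proj₂ (proj₂ (next-permutation α) i) refl

  prev-end : ∀ a → prev (end a) (input a) ≡ start a
  prev-end a = next-injective (input a) (next-prev (end a) (input a))

  -- A permutation of {0,1} commutes with i ↦ 1-i and is an involution.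
  next-opposite-next : ∀ i α → next (opposite (next i α)) α ≡ opposite i
  next-opposite-next i α with ≡⊎≡opposite i (next i α)
  ... | inj₂ eq = trans (cong (λ k → next k α) (trans (cong opposite eq) (opposite-involutive i))) eq
  ... | inj₁ eq with ≡⊎≡opposite i (next (opposite i) α)
  -- Here `α` would send both states to `i`, against injectivity.
  ...   | inj₁ eq′ = ⊥-elim (opposite-≢ i (next-injective α (trans eq (sym eq′))))
  ...   | inj₂ eq′ = trans (cong (λ k → next (opposite k) α) eq) eq′

  start-θ : ∀ a → start (θ a) ≡ opposite (end a)
  start-θ a = start-output _ _

  input-θ : ∀ a → input (θ a) ≡ input a
  input-θ a = input-output _ _

  end-θ : ∀ a → end (θ a) ≡ opposite (start a)
  end-θ a = trans (end-output _ _) (next-opposite-next (start a) (input a))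

  -- Exchanging and complementing the two end states twice restores the start, and the input never
  -- changes; start and input determine the letter.
  θ-involutive : ∀ a → θ (θ a) ≡ a
  θ-involutive a = trans
    (cong₂ output (trans (cong opposite (end-θ a)) (opposite-involutive (start a))) (input-θ a))
    (output-start-input a)

  -- Paths in the transducer.

  infixr 5 _∷_
  -- Distinct outputs make each letter a single edge, so the output word is enough to record the
  -- edges of a path.
  data Path : State → List A → State → Set where
    []  : ∀ {i} → Path i [] i
    _∷_ : ∀ {i w j a} → start a ≡ i → Path (end a) w j → Path i (a ∷ w) j

  infixr 5 _++ₚ_
  _++ₚ_ : ∀ {i j k v w} → Path i v j → Path j w k → Path i (v ++ w) k
  []      ++ₚ q = q
  (e ∷ p) ++ₚ q = e ∷ (p ++ₚ q)

  split : ∀ {i k} v {w} → Path i (v ++ w) k → ∃ λ j → Path i v j × Path j w k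
  split []      p       = _ , [] , p
  split (a ∷ v) (e ∷ p) = let (j , q , r) = split v p in j , e ∷ q , r

  edge : ∀ {i j a} → start a ≡ i → end a ≡ j → Path i [ a ] j
  edge e refl = e ∷ []

  path-start : ∀ {i i′ j j′ w} → w ≢ [] → Path i w j → Path i′ w j′ → i ≡ i′
  path-start w≢[] []      _        = ⊥-elim (w≢[] refl)
  path-start _    (e ∷ _) (e′ ∷ _) = trans (sym e) e′

  path-end-unique : ∀ {i j j′ w} → Path i w j → Path i w j′ → j ≡ j′
  path-end-unique []         []          = refl
  path-end-unique (refl ∷ p) (refl ∷ p′) = path-end-unique p p′

  -- The first letter fixes the start, and from a given start the word fixes the end. The empty word
  -- labels a path at each state, hence its exclusion.
  path-end : ∀ {i i′ j j′ w} → w ≢ [] → Path i w j → Path i′ w j′ → j ≡ j′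
  path-end w≢[] p p′ with refl ← path-start w≢[] p p′ = path-end-unique p p′

  -- Edges meeting at a state `k` are turned by `θ` into edges meeting at `opposite k` in the other
  -- order, so reversing the word gives a path again.
  path-inverse : ∀ {i w j} → Path i w j → Path (opposite j) (inverse θ w) (opposite i)
  path-inverse []                      = []
  path-inverse (_∷_ {w = w} {a = a} refl p) =
    subst (λ z → Path _ z _) (sym (unfold-reverse (θ a) (map θ w)))
      (path-inverse p ++ₚ edge (start-θ a) (end-θ a))

  map-input-inverse : ∀ w → map input (inverse θ w) ≡ reverse (map input w)
  map-input-inverse w = begin
    map input (reverse (map θ w))  ≡⟨ reverse-map input (map θ w) ⟩
    reverse (map input (map θ w))  ≡⟨ cong reverse (sym (map-∘ w)) ⟩
    reverse (map (input ∘ θ) w)    ≡⟨ cong reverse (map-cong input-θ w) ⟩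
    reverse (map input w)          ∎
    where open ≡-Reasoning

  -- After `a` a path continues from `end a`, whereas `θ a` starts at the other state.
  path-reduced : ∀ {i w j} → Path i w j → Reduced θ w
  path-reduced p x a y refl with split x p
  ... | _ , _ , (_ ∷ e ∷ _) = opposite-≢ (end a) (trans (sym e) (start-θ a))

  δ-path : ∀ i u → ∃ λ j → Path i (δ i u) j
  δ-path i []      = i , []
  δ-path i (α ∷ u) = let (j , p) = δ-path (next i α) u in
    j , start-output i α ∷ subst (λ k → Path k (δ (next i α) u) j) (sym (end-output i α)) p

  -- With `δ-path` and `δ-map-input`, this makes `δ i` and `map input` inverse bijections between
  -- input words and labels of paths from `i`.
  map-input-δ : ∀ i u → map input (δ i u) ≡ u
  map-input-δ i []      = refl
  map-input-δ i (α ∷ u) = cong₂ _∷_ (input-output i α) (map-input-δ (next i α) u)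

  δ-map-input : ∀ {i w j} → Path i w j → δ i (map input w) ≡ w
  δ-map-input []         = refl
  δ-map-input (refl ∷ p) = cong₂ _∷_ (output-start-input _) (δ-map-input p)

  -- The image of `T`: membership, inverses, factors and extensions.

  module _ (T : Pred (List Γ) 0ℓ) where

    S : Pred (List A) 0ℓ
    S = doublingImage T

    S⇒path : ∀ {w} → w ∈ S → ∃₂ λ i j → Path i w j
    S⇒path (inj₁ (u , _ , refl)) = 0F , δ-path 0F u
    S⇒path (inj₂ (u , _ , refl)) = 1F , δ-path 1F u

    S⇒input : ∀ {w} → w ∈ S → map input w ∈ T
    S⇒input (inj₁ (u , u∈T , refl)) = subst T (sym (map-input-δ 0F u)) u∈T
    S⇒input (inj₂ (u , u∈T , refl)) = subst T (sym (map-input-δ 1F u)) u∈T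

    -- The start state selects `δ 0F` or `δ 1F`. With `S⇒path` and `S⇒input` this characterises
    -- membership in `S`.
    path⇒S : ∀ {i w j} → Path i w j → map input w ∈ T → w ∈ S
    path⇒S {0F} p t = inj₁ (_ , t , δ-map-input p)
    path⇒S {1F} p t = inj₂ (_ , t , δ-map-input p)

    S-inverse-closed : ClosedUnderReversal T → ∀ {w} → w ∈ S → inverse θ w ∈ S
    S-inverse-closed rev {w} w∈S = let (_ , _ , p) = S⇒path w∈S in
      path⇒S (path-inverse p) (subst T (sym (map-input-inverse w)) (rev (S⇒input w∈S)))

    S-factorial : IsFactorial T → IsFactorial S
    S-factorial fac = record
      { letters = λ a → path⇒S (edge refl refl) (letters (input a))
      ; factors = fact
      }
      where
      open IsFactorial fac
      fact : ∀ x u y → (x ++ u ++ y) ∈ S → u ∈ S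
      fact x u y s with S⇒path s
      ... | _ , _ , p with split x p
      ... | _ , _ , q with split u q
      ... | _ , r , _ = path⇒S r (factors (map input x) (map input u) (map input y)
        (subst T (trans (map-++ input x (u ++ y)) (cong (map input x ++_) (map-++ input u y))) (S⇒input s)))

    before : State → Γ → A
    before i α = output (prev i α) α

    map-input-∷ʳ : ∀ w b → map input (w ∷ʳ b) ≡ map input w ∷ʳ input b
    map-input-∷ʳ w b = map-++ input w [ b ]

    module _ {i j w} (p : Path i w j) where

      path-before : ∀ α → Path (prev i α) (before i α ∷ w) j
      path-before α = edge (start-output _ α) (trans (end-output _ α) (next-prev i α)) ++ₚ p

      path-after : ∀ β → Path i (w ∷ʳ output j β) (next j β)
      path-after β = p ++ₚ edge (start-output j β) (end-output j β)

    module _ {i j w} (p : Path i w j) where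

      left-S : ∀ {α} → α ∈ L T (map input w) → before i α ∈ L S w
      left-S {α} t = path⇒S (path-before p α)
        (subst (λ γ → T (γ ∷ map input w)) (sym (input-output _ α)) t)

      right-S : ∀ {β} → β ∈ R T (map input w) → output j β ∈ R S w
      right-S {β} t = path⇒S (path-after p β)
        (subst T (sym (trans (map-input-∷ʳ w _) (cong (map input w ∷ʳ_) (input-output j β)))) t)

      both-S : ∀ {α β} → (α , β) ∈ B T (map input w) → (before i α , output j β) ∈ B S w
      both-S {α} {β} t = path⇒S (path-before (path-after p β) α)
        (subst T (sym (cong₂ _∷_ (input-output _ α)
          (trans (map-input-∷ʳ w _) (cong (map input w ∷ʳ_) (input-output j β))))) t)

    right-T : ∀ {b} w → b ∈ R S w → input b ∈ R T (map input w)
    right-T w s = subst T (map-input-∷ʳ w _) (S⇒input s)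

    both-T : ∀ {a b} w → (a , b) ∈ B S w → (input a , input b) ∈ B T (map input w)
    both-T w s = subst (λ z → T (_ ∷ z)) (map-input-∷ʳ w _) (S⇒input s)

    -- An extension of the input word in `T` lifts to an edge entering the start of the path and an
    -- edge leaving its end.
    S-biextendable : IsBiextendable T → IsBiextendable S
    S-biextendable bi = record
      { isFactorial = S-factorial isFactorial
      ; extendable  = λ w∈S →
          let (_ , _ , p) = S⇒path w∈S
              (_ , t)     = extendable (S⇒input w∈S)
          in _ , both-S p t
      }
      where open IsBiextendable bi

    -- The vertices that extend a path from i to j to a longer path.
    Fits : State → State → Pred (A ⊎ A) 0ℓ
    Fits i j (inj₁ a) = end a ≡ i
    Fits i j (inj₂ b) = start b ≡ j

    -- Comparison of the extension graphs in `S` and in `T`.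

    module _ (fac : IsFactorial T) where

      ET : List Γ → Graph (Γ ⊎ Γ)
      ET = extensionGraph T fac

      ES : List A → Graph (A ⊎ A)
      ES = extensionGraph S (S-factorial fac)

      -- A letter is determined by its input once its end (on the left) or its start (on the right)
      -- is fixed by `Fits`, so taking inputs is inverted by `f`. The path may be empty, which gives
      -- one tree for each state.
      fitting-tree : ∀ {i j w} → Path i w j → IsTree (ET (map input w)) → IsTree (induced (ES w) (Fits i j))
      fitting-tree {i} {j} {w} p = tree-transfer (ET (map input w)) (induced (ES w) (Fits i j))
        f g (λ {v} → f-vertex v) (λ {v} → g-vertex v)
        (λ {u} {v} → f-adj u v) (λ {u} {v} → g-adj u v) (λ {v} → fg v)
        where
        module ET = Graph (ET (map input w))
        module H = Graph (induced (ES w) (Fits i j))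

        f : Γ ⊎ Γ → A ⊎ A
        f = Sum.map (before i) (output j)

        g : A ⊎ A → Γ ⊎ Γ
        g = Sum.map input input

        f-fits : ∀ v → Fits i j (f v)
        f-fits (inj₁ α) = trans (end-output _ α) (next-prev i α)
        f-fits (inj₂ β) = start-output j β

        f-vertex : ∀ v → ET.Vertex v → H.Vertex (f v)
        f-vertex (inj₁ α) t = left-S p t , f-fits (inj₁ α)
        f-vertex (inj₂ β) t = right-S p t , f-fits (inj₂ β)

        g-vertex : ∀ v → H.Vertex v → ET.Vertex (g v)
        g-vertex (inj₁ a) (s , _) = S⇒input s
        g-vertex (inj₂ b) (s , _) = right-T w s

        f-adj : ∀ u v → ET.Adj u v → H.Adj (f u) (f v)
        f-adj u@(inj₁ _) v@(inj₂ _) t = both-S p t , f-fits u , f-fits v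
        f-adj u@(inj₂ _) v@(inj₁ _) t = both-S p t , f-fits u , f-fits v

        g-adj : ∀ u v → H.Adj u v → ET.Adj (g u) (g v)
        g-adj (inj₁ _) (inj₂ _) (s , _) = both-T w s
        g-adj (inj₂ _) (inj₁ _) (s , _) = both-T w s

        fg : ∀ v → H.Vertex v → f (g v) ≡ v
        fg (inj₁ a) (_ , refl) = cong inj₁
          (trans (cong (λ k → output k (input a)) (prev-end a)) (output-start-input a))
        fg (inj₂ b) (_ , refl) = cong inj₂ (output-start-input b)

      -- In a path labelled by the extended word, the part labelled by `w` has the same end states
      -- as `p`, so the added letter meets `w` at `i` or `j`.
      fits-nonempty : ∀ {i j w} → w ≢ [] → Path i w j → Graph.Vertex (ES w) ⊆ Fits i j
      fits-nonempty w≢[] p {inj₁ a} s with S⇒path s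
      ... | _ , _ , (_ ∷ q) = path-start w≢[] q p
      fits-nonempty {w = w} w≢[] p {inj₂ b} s with S⇒path s
      ... | _ , _ , q with split w q
      ... | _ , r , (e ∷ _) = trans e (path-end w≢[] r p)

      -- The parts correspond to the state at which the empty path is placed. Adjacent letters are
      -- consecutive edges, so they meet at that state and share a part.
      two-trees : IsTree (ET []) → IsDisjointUnionOfTrees 2 (ES [])
      two-trees t = record
        { Part     = λ i → Fits i i
        ; covers   = λ {v} _ → covers v
        ; disjoint = λ {i} {j} {v} → disjoint {i} {j} v
        ; closed   = λ {i} {u} {v} → closed {i} u v
        ; trees    = λ i → fitting-tree {i} [] t
        }
        where
        covers : ∀ v → ∃ λ i → Fits i i v
        covers (inj₁ a) = end a , refl
        covers (inj₂ b) = start b , refl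

        disjoint : ∀ {i j} v → Fits i i v → Fits j j v → i ≡ j
        disjoint (inj₁ _) e e′ = trans (sym e) e′
        disjoint (inj₂ _) e e′ = trans (sym e) e′

        consecutive : ∀ {a b} → (a ∷ b ∷ []) ∈ S → start b ≡ end a
        consecutive s with S⇒path s
        ... | _ , _ , (_ ∷ e ∷ _) = e

        closed : ∀ {i} u v → Graph.Adj (ES []) u v → Fits i i u → Fits i i v
        closed (inj₁ _) (inj₂ _) s e = trans (consecutive s) e
        closed (inj₂ _) (inj₁ _) s e = trans (sym (consecutive s)) e

    -- The tree condition and specularity.

    S-treeSet : IsTreeSet T 1 → IsTreeSet S 2
    S-treeSet ts = record
      { isBiextendable = S-biextendable isBiextendable
      ; nonempty-words = λ {w} → nonempty {w}
      ; empty-word     = two-trees isFactorial (tree-of-one _ empty-word)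
      }
      where
      open IsTreeSet ts
      nonempty : ∀ {w} → w ∈ S → w ≢ [] → IsTree (ES isFactorial w)
      nonempty {[]}    _   w≢[] = ⊥-elim (w≢[] refl)
      -- The case split makes `map input w` visibly nonempty. All vertices fit the path, so the
      -- fitting subgraph is the whole extension graph.
      nonempty {_ ∷ _} w∈S w≢[] = let (_ , _ , p) = S⇒path w∈S in
        tree-of-full-induced _ (λ {v} → fits-nonempty isFactorial w≢[] p {v})
          (fitting-tree isFactorial p (nonempty-words (S⇒input w∈S) λ ()))

    S-specular : IsTreeSet T 1 → ClosedUnderReversal T → IsSpecular θ S
    S-specular ts rev = record
      { isLaminary = record
        { involutive     = θ-involutive
        ; isBiextendable = S-biextendable (IsTreeSet.isBiextendable ts)
        ; reduced        = λ w∈S → path-reduced (proj₂ (proj₂ (S⇒path w∈S)))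
        ; inverse-closed = S-inverse-closed rev
        }
      ; isTreeSet = S-treeSet ts
      }

theorem4p20 : ∀ {m n : ℕ} (T : Pred (List (Fin m)) 0ℓ) → IsTreeSet T 1 → ClosedUnderReversal T →
    (𝒜 : DoublingTransducer (Fin m) (Fin n)) →
    IsSpecular (DoublingTransducer.θ 𝒜) (DoublingTransducer.doublingImage 𝒜 T)
theorem4p20 T ts rev 𝒜 = Transducer.S-specular 𝒜 T ts rev
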